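{- Let $P$ be a partial monoid and let $R$ be the semi-Thue system on $P^*$ associated with $P$. Then $R$ is confluent if, and only if, there is no critical pair of type (A0); equivalently, $R$ is confluent if, and only if, each essential critical pair of type (A) is of type (A1).
   Context: A partial monoid is a nonempty set $P$ with a partial function $\times:P\times P\to P$ with domain $\mathrm{dom}(\times)\subseteq P\times P$ and an element $1_P\in P$ such that: (1) for every $x\in P$, $(x,1_P),(1_P,x)\in\mathrm{dom}(\times)$ and $x\times 1_P=x=1_P\times x$; (2) for all $x,y,z\in P$, [$(x,y)\in\mathrm{dom}(\times)$ and $(x\times y,z)\in\mathrm{dom}(\times)$] if and only if [$(y,z)\in\mathrm{dom}(\times)$ and $(x,y\times z)\in\mathrm{dom}(\times)$], and in this case $(x\times y)\times z=x\times(y\times z)$. $P^*$ is the free monoid of words over the alphabet $P$, $\epsilon$ is the empty word, and $i_P:P\hookrightarrow P^*$ sends $x$ to the one-letter word $x$. The semi-Thue system associated with $P$ is $R=\{(i_P(x)i_P(y),\,i_P(x\times y)):(x,y)\in\mathrm{dom}(\times)\}\cup\{(i_P(1_P),\epsilon)\}$. Its one-step reduction is: $uav\Rightarrow_R ubv$ for $u,v\in P^*$, $(a,b)\in R$. $\Rightarrow_R^*$ is the reflexive-transitive closure. $R$ is confluent if whenever $a\Rightarrow_R^* b$ and $a\Rightarrow_R^* c$ there is $d$ with $b\Rightarrow_R^* d$ and $c\Rightarrow_R^* d$. An essential critical pair is a pair of words $(i_P(a)i_P(z),\,i_P(x)i_P(b))$, with $a,b,x,z\in P$, such that there is some $y\in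 P$ with $(x,y)\in\mathrm{dom}(\times)$, $(y,z)\in\mathrm{dom}(\times)$, $x\times y=a$ and $y\times z=b$ (it arises from the two reductions of $i_P(x)i_P(y)i_P(z)$). It is of type (A) if $(a,z)\notin\mathrm{dom}(\times)$ (and therefore $(x,b)\notin\mathrm{dom}(\times)$). A pair of type (A) is of type (A1) if $a=x$ and $b=z$, and of type (A0) if $a\ne x$ or $b\neq z$. -}

module Defs where

open import Data.List.Base using (List; []; [_]; _++_)
open import Data.Product.Base using (Σ-syntax; ∃-syntax; _×_; _,_)
open import Data.Sum.Base using (_⊎_)
open import Function.Bundles using (_⇔_)
open import Level using (Level; _⊔_; suc)
open import Relation.Binary.Core using (Rel)
open import Relation.Binary.PropositionalEquality.Core using (_≡_; _≢_)
open import Relation.Nullary.Negation.Core using (¬_)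

-- A partial product is a domain `Dom` together with a product `mul` on it;
-- `mul-unique` makes the product depend on the two factors only, and not on
-- the proof that they lie in the domain.

record PartialMonoid (c d : Level) : Set (suc (c ⊔ d)) where
  field
    Carrier    : Set c
    Dom        : Rel Carrier d
    mul        : ∀ x y → Dom x y → Carrier
    mul-unique : ∀ {x y} (p q : Dom x y) → mul x y p ≡ mul x y q
    1#         : Carrier

    identityʳ-dom : ∀ x → Dom x 1#
    identityˡ-dom : ∀ x → Dom 1# x
    identityʳ     : ∀ x → mul x 1# (identityʳ-dom x) ≡ x
    identityˡ     : ∀ x → mul 1# x (identityˡ-dom x) ≡ x

    assoc-dom : ∀ x y z →
      (Σ[ xy ∈ Dom x y ] Dom (mul x y xy) z) ⇔ (Σ[ yz ∈ Dom y z ] Dom x (mul y z yz))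
    assoc     : ∀ {x y z}
      (xy : Dom x y) (xy-z : Dom (mul x y xy) z)
      (yz : Dom y z) (x-yz : Dom x (mul y z yz)) →
      mul (mul x y xy) z xy-z ≡ mul x (mul y z yz) x-yz

module _ {c d : Level} (P : PartialMonoid c d) where
  open PartialMonoid P

  Word : Set c
  Word = List Carrier

  data Rule : Rel Word (c ⊔ d) where
    product : ∀ {x y} (xy : Dom x y) → Rule ([ x ] ++ [ y ]) [ mul x y xy ]
    unit    : Rule [ 1# ] []

  data Step : Rel Word (c ⊔ d) where
    step : ∀ u v {a b} → Rule a b → Step (u ++ a ++ v) (u ++ b ++ v)

  -- The pair of words determines its letters a, z, x, b, whereas y is only
  -- required to exist.

  record EssentialCriticalPair : Set (c ⊔ d) where
    field
      a z x b : Carrier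
      middle  : ∃[ y ] Σ[ xy ∈ Dom x y ] Σ[ yz ∈ Dom y z ]
                  (mul x y xy ≡ a × mul y z yz ≡ b)

    words : Word × Word
    words = [ a ] ++ [ z ] , [ x ] ++ [ b ]

  module _ (π : EssentialCriticalPair) where
    open EssentialCriticalPair π

    TypeA : Set d
    TypeA = ¬ Dom a z

    TypeA1 : Set (c ⊔ d)
    TypeA1 = TypeA × (a ≡ x × b ≡ z)

    TypeA0 : Set (c ⊔ d)
    TypeA0 = TypeA × (a ≢ x ⊎ b ≢ z)

{-# OPTIONS --safe #-}

-- Reductions shorten words, so by Newman's lemma confluence amounts to local
-- confluence.  Two redexes that are not disjoint are resolved by the monoid
-- laws, except for essential critical pairs of type (A); both words of such a
-- pair are irreducible, so it can be joined only if its two words coincide.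

module Submission where

open import Defs
open import Axiom.ExcludedMiddle using (ExcludedMiddle)
open import Data.List.Base using ([]; _∷_; length)
open import Data.List.Properties using (∷-injective)
open import Data.Nat.Base using (_<_; s≤s)
open import Data.Nat.Induction using (<-wellFounded)
open import Data.Nat.Properties using (<-trans; n<1+n)
open import Data.Product.Base using (∃-syntax; _×_; _,_)
open import Data.Sum.Base using (inj₁; inj₂)
open import Function.Base using (_∘_)
open import Function.Bundles using (_⇔_; mk⇔; Equivalence)
open import Induction.WellFounded using (module Subrelation)
open import Level using (_⊔_)
open import Relation.Binary.Construct.Closure.Equivalence.Properties
  using (a—↠b&a—↠c⇒b↔c)
open import Relation.Binary.Construct.Closure.ReflexiveTransitive
  using (Star; ε; gmap; return)
open import Relation.Binary.Construct.Closure.Transitive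
  using (Plus; [_]; _∼⁺⟨_⟩_)
import Relation.Binary.Construct.On as On
open import Relation.Binary.Core using (Rel; _⇒_)
open import Relation.Binary.Definitions using (Decidable)
open import Relation.Binary.PropositionalEquality
  using (_≡_; refl; sym; trans; cong; subst)
open import Relation.Binary.Rewriting
open import Relation.Nullary.Decidable.Core using (yes; no)
open import Relation.Nullary.Negation.Core using (¬_; contradiction)

module _ {c d} (P : PartialMonoid c d) where
  open PartialMonoid P

  private
    _↠_ : Rel (Word P) (c ⊔ d)
    _↠_ = Star (Step P)

  -- `Step` locates the redex by splitting the word; locating it by recursion
  -- on the word makes the overlaps of two redexes a plain case analysis.
  data _⟶_ : Rel (Word P) (c ⊔ d) where
    multiply : ∀ {x y v} (xy : Dom x y) → (x ∷ y ∷ v) ⟶ (mul x y xy ∷ v)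
    erase    : ∀ {x v} → x ≡ 1# → (x ∷ v) ⟶ v
    there    : ∀ {x u v} → u ⟶ v → (x ∷ u) ⟶ (x ∷ v)

  Step⇒⟶ : Step P ⇒ _⟶_
  Step⇒⟶ (step []      v (product xy)) = multiply xy
  Step⇒⟶ (step []      v unit)         = erase refl
  Step⇒⟶ (step (x ∷ u) v r)            = there (Step⇒⟶ (step u v r))

  Step-∷ : ∀ {x u v} → Step P u v → Step P (x ∷ u) (x ∷ v)
  Step-∷ {x} (step u v r) = step (x ∷ u) v r

  ⟶⇒Step : _⟶_ ⇒ Step P
  ⟶⇒Step (multiply {v = v} xy)  = step [] v (product xy)
  ⟶⇒Step (erase {v = v} refl)   = step [] v unit
  ⟶⇒Step (there s)              = Step-∷ (⟶⇒Step s)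

  ⟶-length : ∀ {u v} → u ⟶ v → length v < length u
  ⟶-length (multiply _) = n<1+n _
  ⟶-length (erase _)    = n<1+n _
  ⟶-length (there s)    = s≤s (⟶-length s)

  Step⁺-length : ∀ {u v} → Plus (Step P) u v → length v < length u
  Step⁺-length [ s ]          = ⟶-length (Step⇒⟶ s)
  Step⁺-length (_ ∼⁺⟨ s ⟩ t) = <-trans (Step⁺-length t) (Step⁺-length s)

  -- The form of termination that `sn&wcr⇒cr` takes concerns nonempty chains of steps; word length
  -- is the measure.
  Step⁺-stronglyNormalizing : StronglyNormalizing (Plus (Step P))
  Step⁺-stronglyNormalizing =
    Subrelation.wellFounded Step⁺-length (On.wellFounded length <-wellFounded)

  mul-identityˡ : ∀ {y} (p : Dom 1# y) → mul 1# y p ≡ y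
  mul-identityˡ {y} p = trans (mul-unique p _) (identityˡ y)

  mul-identityʳ : ∀ {x} (p : Dom x 1#) → mul x 1# p ≡ x
  mul-identityʳ {x} p = trans (mul-unique p _) (identityʳ x)

  -- `assoc-dom` yields its own proof that `y` and `z` are composable; `mul-unique` carries the
  -- result over to the given one.
  dom-reassocʳ : ∀ {x y z} (xy : Dom x y) (yz : Dom y z) →
                 Dom (mul x y xy) z → Dom x (mul y z yz)
  dom-reassocʳ {x} {y} {z} xy yz xy-z
    with yz′ , x-yz ← Equivalence.to (assoc-dom x y z) (xy , xy-z)
    = subst (Dom x) (mul-unique yz′ yz) x-yz

  dom-reassocˡ : ∀ {x y z} (xy : Dom x y) (yz : Dom y z) →
                 Dom x (mul y z yz) → Dom (mul x y xy) z
  dom-reassocˡ {x} {y} {z} xy yz x-yz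
    with xy′ , xy-z ← Equivalence.from (assoc-dom x y z) (yz , x-yz)
    = subst (λ a → Dom a z) (mul-unique xy′ xy) xy-z

  Joinable : Rel (Word P) (c ⊔ d)
  Joinable u v = ∃[ w ] (u ↠ w × v ↠ w)

  ≡⇒joinable : ∀ {u v} → u ≡ v → Joinable u v
  ≡⇒joinable refl = _ , ε , ε

  joinable-sym : ∀ {u v} → Joinable u v → Joinable v u
  joinable-sym (w , p , q) = w , q , p

  joinable-∷ : ∀ {x u v} → Joinable u v → Joinable (x ∷ u) (x ∷ v)
  joinable-∷ (w , p , q) = _ , gmap _ Step-∷ p , gmap _ Step-∷ q

  ⟶-joinable : ∀ {u v w} → u ⟶ w → v ⟶ w → Joinable u v
  ⟶-joinable s t = _ , return (⟶⇒Step s) , return (⟶⇒Step t)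

  module _ (dom? : Decidable Dom) (A⇒A1 : ∀ π → TypeA P π → TypeA1 P π) where

    -- If the triple product exists, associativity joins both words in it. Otherwise the pair is of
    -- type (A), hence (A1), and the two words are already equal.
    essential-joinable : ∀ {x y z v} (xy : Dom x y) (yz : Dom y z) →
      Joinable (mul x y xy ∷ z ∷ v) (x ∷ mul y z yz ∷ v)
    essential-joinable {x} {y} {z} {v} xy yz with dom? (mul x y xy) z
    ... | yes xy-z = ⟶-joinable (multiply xy-z)
      (subst (λ w → (x ∷ mul y z yz ∷ v) ⟶ (w ∷ v))
             (sym (assoc xy xy-z yz x-yz)) (multiply x-yz))
      where x-yz = dom-reassocʳ xy yz xy-z
    ... | no ¬xy-z
      with _ , a≡x , b≡z ← A⇒A1
             (record { middle = y , xy , yz , refl , refl }) ¬xy-z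
      rewrite a≡x | b≡z = ≡⇒joinable refl

    -- A redex in the tail can meet the front product only at `y`: either `y` is a factor of a
    -- second product, or it is the unit and gets erased. Any other redex commutes with the product.
    multiply-joinable : ∀ {x y u v} (xy : Dom x y) → (y ∷ u) ⟶ v →
                        Joinable (mul x y xy ∷ u) (x ∷ v)
    multiply-joinable xy (multiply yz) = essential-joinable xy yz
    multiply-joinable xy (erase refl)  = ≡⇒joinable (cong (_∷ _) (mul-identityʳ xy))
    multiply-joinable xy (there s)     = ⟶-joinable (there s) (multiply xy)

    ⟶-locallyConfluent : ∀ {u v w} → u ⟶ v → u ⟶ w → Joinable v w
    ⟶-locallyConfluent (multiply p) (multiply q) = ≡⇒joinable (cong (_∷ _) (mul-unique p q))
    ⟶-locallyConfluent (multiply p) (erase refl) = ≡⇒joinable (cong (_∷ _) (mul-identityˡ p))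
    ⟶-locallyConfluent (multiply p) (there t)    = multiply-joinable p t
    ⟶-locallyConfluent (erase refl) (multiply q) = ≡⇒joinable (cong (_∷ _) (sym (mul-identityˡ q)))
    ⟶-locallyConfluent (erase _)    (erase _)    = ≡⇒joinable refl
    ⟶-locallyConfluent (erase p)    (there t)    = ⟶-joinable t (erase p)
    ⟶-locallyConfluent (there s)    (multiply q) = joinable-sym (multiply-joinable q s)
    ⟶-locallyConfluent (there s)    (erase q)    = ⟶-joinable (erase q) s
    ⟶-locallyConfluent (there s)    (there t)    = joinable-∷ (⟶-locallyConfluent s t)

    A⇒A1→confluent : Confluent (Step P)
    A⇒A1→confluent = sn&wcr⇒cr Step⁺-stronglyNormalizing
      λ s t → ⟶-locallyConfluent (Step⇒⟶ s) (Step⇒⟶ t)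

  -- Neither letter can be erased: the unit is composable with every element on either side.
  ¬dom⇒normalForm : ∀ {x y} → ¬ Dom x y → IsNormalForm (Step P) (x ∷ y ∷ [])
  ¬dom⇒normalForm {x} {y} ¬xy (_ , s) with Step⇒⟶ s
  ... | multiply xy          = ¬xy xy
  ... | erase refl           = ¬xy (identityˡ-dom y)
  ... | there (erase refl)   = ¬xy (identityʳ-dom x)

  confluent→A⇒A1 : Confluent (Step P) → ∀ π → TypeA P π → TypeA1 P π
  confluent→A⇒A1 conf
    record { z = z ; x = x ; middle = y , xy , yz , refl , refl } ¬xy-z
    with az≡xb ← conf⇒unf conf
           (¬dom⇒normalForm ¬xy-z)
           -- Reassociation transfers non-composability from the first word to the second.
           (¬dom⇒normalForm (¬xy-z ∘ dom-reassocˡ xy yz))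
           -- Both words are reducts of `x ∷ y ∷ z ∷ []`, so they are convertible normal forms.
           (a—↠b&a—↠c⇒b↔c
             (return (⟶⇒Step (multiply xy)))
             (return (⟶⇒Step (there (multiply yz)))))
    with a≡x , z∷≡b∷ ← ∷-injective az≡xb
    with z≡b , _ ← ∷-injective z∷≡b∷
    = ¬xy-z , a≡x , sym z≡b

  A⇒A1→¬A0 : (∀ π → TypeA P π → TypeA1 P π) → ¬ (∃[ π ] TypeA0 P π)
  A⇒A1→¬A0 A⇒A1 (π , A , a≢x⊎b≢z) with A⇒A1 π A | a≢x⊎b≢z
  ... | _ , a≡x , _   | inj₁ a≢x = a≢x a≡x
  ... | _ , _   , b≡z | inj₂ b≢z = b≢z b≡z

  -- Absence of type (A0) only refutes the inequalities; deciding equality of letters turns this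
  -- into the equations of (A1).
  ¬A0→A⇒A1 : Decidable {A = Carrier} _≡_ →
             ¬ (∃[ π ] TypeA0 P π) → ∀ π → TypeA P π → TypeA1 P π
  ¬A0→A⇒A1 _≟_ ¬A0 π A with a ≟ x | b ≟ z
    where open EssentialCriticalPair π
  ... | yes a≡x | yes b≡z = A , a≡x , b≡z
  ... | no a≢x  | _       = contradiction (π , A , inj₁ a≢x) ¬A0
  ... | _       | no b≢z  = contradiction (π , A , inj₂ b≢z) ¬A0

lemma3 : ∀ {c d} → ExcludedMiddle c → ExcludedMiddle d →
    (P : PartialMonoid c d) →
    (Confluent (Step P) ⇔ (¬ (∃[ π ] TypeA0 P π))) ×
    (Confluent (Step P) ⇔ (∀ π → TypeA P π → TypeA1 P π))
lemma3 em-c em-d P =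
  mk⇔ (A⇒A1→¬A0 P ∘ confluent→A⇒A1 P)
      (A⇒A1→confluent P dom? ∘ ¬A0→A⇒A1 P (λ _ _ → em-c)) ,
  mk⇔ (confluent→A⇒A1 P) (A⇒A1→confluent P dom?)
  where
  -- Classically every essential pair either is of type (A) or has a defined triple product.
  dom? : Decidable (PartialMonoid.Dom P)
  dom? _ _ = em-d
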